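{- The Gentzen calculus $\mathcal G_{\mathcal{LB}}$ is algebraizable with respect to the variety $\mathsf{DBiLat}$ of distributive bilattices, with the following translations: $$\tau(\Gamma\rhd\Delta)=\{\bigwedge\Gamma\land(\bigwedge\Gamma\otimes\bigvee\Delta)\approx\bigwedge\Gamma\},$$ $$\rho(\varphi\approx\psi)=\{\varphi\rhd\psi,\ \neg\varphi\rhd\neg\psi,\ \psi\rhd\varphi,\ \neg\psi\rhd\neg\varphi\}.$$
   Context: A bilattice is an algebra $\langle B,\land,\lor,\otimes,\oplus,\neg\rangle$ such that $\langle B,\land,\lor\rangle$ and $\langle B,\otimes,\oplus\rangle$ are lattices (not necessarily bounded) with associated orders $\leq_t$ and $\leq_k$, and $\neg$ is a unary operation such that for all $a,b$: $a\leq_t b$ implies $\neg b\leq_t\neg a$; $a\leq_k b$ implies $\neg a\leq_k\neg b$; $\neg\neg a=a$. It is distributive if $x\circ(y\bullet z)\approx(x\circ y)\bullet(x\circ z)$ holds for all distinct $\circ,\bullet\in\{\land,\lor,\otimes,\oplus\}$. Formulas are built from a countable set of variables in the language $\{\land,\lor,\otimes,\oplus,\neg\}$. A sequent $\Gamma\rhd\Delta$ is a pair of finite non-empty sets of formulas. $\bigwedge\Gamma$ and $\bigvee\Delta$ denote the conjunction ($\land$) and disjunction ($\lor$) of the members of the set (in some fixed order and bracketing). The calculus $\mathcal G_{\mathcal{LB}}$ has the axiom $\Gamma,\varphi\rhd\varphi,\Delta$, the Cut rule (from $\Gamma\rhd\Delta,\varphi$ and $\Gamma,\varphi\rhd\Delta$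 infer $\Gamma\rhd\Delta$, and, more generally, from $\Gamma\rhd\Delta,\varphi$ and $\Gamma',\varphi\rhd\Delta'$ infer $\Gamma,\Gamma'\rhd\Delta,\Delta'$), and the following logical rules (here $\Gamma,\Delta$ may be empty as long as the sequents involved have both sides non-empty): - $(\land\rhd)$ from $\Gamma,\varphi,\psi\rhd\Delta$ infer $\Gamma,\varphi\land\psi\rhd\Delta$; $(\rhd\land)$ from $\Gamma\rhd\Delta,\varphi$ and $\Gamma\rhd\Delta,\psi$ infer $\Gamma\rhd\Delta,\varphi\land\psi$; - $(\neg\land\rhd)$ from $\Gamma,\neg\varphi\rhd\Delta$ and $\Gamma,\neg\psi\rhd\Delta$ infer $\Gamma,\neg(\varphi\land\psi)\rhd\Delta$; $(\rhd\neg\land)$ from $\Gamma\rhd\Delta,\neg\varphi,\neg\psi$ infer $\Gamma\rhd\Delta,\neg(\varphi\land\psi)$; - $(\lor\rhd)$ from $\Gamma,\varphi\rhd\Delta$ and $\Gamma,\psi\rhd\Delta$ infer $\Gamma,\varphi\lor\psi\rhd\Delta$; $(\rhd\lor)$ from $\Gamma\rhd\Delta,\varphi,\psi$ infer $\Gamma\rhd\Delta,\varphi\lor\psi$; - $(\neg\lor\rhd)$ from $\Gamma,\neg\varphi,\neg\psi\rhd\Delta$ infer $\Gamma,\neg(\varphi\lor\psi)\rhd\Delta$; $(\rhd\neg\lor)$ from $\Gamma\rhd\Delta,\neg\varphi$ and $\Gamma\rhd\Delta,\neg\psi$ infer $\Gamma\rhd\Delta,\neg(\varphi\lor\psi)$;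 - $(\otimes\rhd)$ from $\Gamma,\varphi,\psi\rhd\Delta$ infer $\Gamma,\varphi\otimes\psi\rhd\Delta$; $(\rhd\otimes)$ from $\Gamma\rhd\Delta,\varphi$ and $\Gamma\rhd\Delta,\psi$ infer $\Gamma\rhd\Delta,\varphi\otimes\psi$; - $(\neg\otimes\rhd)$ from $\Gamma,\neg\varphi,\neg\psi\rhd\Delta$ infer $\Gamma,\neg(\varphi\otimes\psi)\rhd\Delta$; $(\rhd\neg\otimes)$ from $\Gamma\rhd\Delta,\neg\varphi$ and $\Gamma\rhd\Delta,\neg\psi$ infer $\Gamma\rhd\Delta,\neg(\varphi\otimes\psi)$; - $(\oplus\rhd)$ from $\Gamma,\varphi\rhd\Delta$ and $\Gamma,\psi\rhd\Delta$ infer $\Gamma,\varphi\oplus\psi\rhd\Delta$; $(\rhd\oplus)$ from $\Gamma\rhd\Delta,\varphi,\psi$ infer $\Gamma\rhd\Delta,\varphi\oplus\psi$; - $(\neg\oplus\rhd)$ from $\Gamma,\neg\varphi\rhd\Delta$ and $\Gamma,\neg\psi\rhd\Delta$ infer $\Gamma,\neg(\varphi\oplus\psi)\rhd\Delta$; $(\rhd\neg\oplus)$ from $\Gamma\rhd\Delta,\neg\varphi,\neg\psi$ infer $\Gamma\rhd\Delta,\neg(\varphi\oplus\psi)$; - $(\neg\neg\rhd)$ from $\Gamma,\varphi\rhd\Delta$ infer $\Gamma,\neg\neg\varphi\rhd\Delta$; $(\rhd\neg\neg)$ from $\Gamma\rhd\Delta,\varphi$ infer $\Gamma\rhd\Delta,\neg\neg\varphi$.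 For a set $S$ of sequents and a sequent $s$, write $S\mathrel{|\!\sim} s$ if $s$ is derivable from the members of $S$ and axioms by finitely many applications of the rules. For a class $\mathsf K$ of algebras, $\models_{\mathsf K}$ is the equational consequence relation of $\mathsf K$. Algebraizability of $\mathcal G_{\mathcal{LB}}$ with respect to $\mathsf K$ with translations $\tau$ (sequents to finite sets of equations) and $\rho$ (equations to finite sets of sequents) means: (1) for every set $S\cup\{s\}$ of sequents, $S\mathrel{|\!\sim}s$ iff $\bigcup_{s'\in S}\tau(s')\models_{\mathsf K}\tau(s)$; and (2) for every equation $\varphi\approx\psi$, the sets $\{\varphi\approx\psi\}$ and $\bigcup\{\tau(s): s\in\rho(\varphi\approx\psi)\}$ are interderivable with respect to $\models_{\mathsf K}$. -}

module Defs where

open import Algebra.Core using (Op₁; Op₂)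
open import Algebra.Definitions using (Congruent₁; Congruent₂; _DistributesOverˡ_)
open import Algebra.Lattice.Structures using (IsLattice)
open import Data.List.Base using (List; []; _∷_; _++_)
open import Data.List.Membership.Propositional using () renaming (_∈_ to _∈ˡ_)
open import Data.List.NonEmpty.Base using (List⁺; _∷_; _⁺++_; _++⁺_; [_]; foldr₁; toList)
open import Data.List.Relation.Binary.BagAndSetEquality using (_∼[_]_; set)
open import Data.Nat.Base using (ℕ)
open import Data.Product.Base using (∃; _×_)
open import Function.Bundles using (_⇔_)
open import Level using (Level; _⊔_; 0ℓ) renaming (suc to lsuc)
open import Relation.Binary.Core using (Rel)
import Relation.Binary.Construct.NaturalOrder.Left as NaturalOrder
open import Relation.Binary.PropositionalEquality.Core using (_≢_)
open import Relation.Binary.Structures using (IsEquivalence)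
open import Relation.Unary using (Pred; _∈_; ｛_｝)

private
  variable
    c ℓ k p q : Level

------------------------------------------------------------------------
-- Algebras and distributive bilattices

-- Algebras are setoid-based, as in Algebra.Bundles: _≈_ is the equality
-- of the algebra, and the operations are required to respect it.

record Algebra c ℓ : Set (lsuc (c ⊔ ℓ)) where
  infix  9 ¬_
  infixr 8 _⊗_
  infixr 7 _∧_ _⊕_
  infixr 6 _∨_
  infix  4 _≈_
  field
    Carrier       : Set c
    _≈_           : Rel Carrier ℓ
    isEquivalence : IsEquivalence _≈_
    _∧_ _∨_ _⊗_ _⊕_ : Op₂ Carrier
    ¬_            : Op₁ Carrier
    ∧-cong        : Congruent₂ _≈_ _∧_
    ∨-cong        : Congruent₂ _≈_ _∨_
    ⊗-cong        : Congruent₂ _≈_ _⊗_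
    ⊕-cong        : Congruent₂ _≈_ _⊕_
    ¬-cong        : Congruent₁ _≈_ ¬_

  open NaturalOrder _≈_ _∧_ public using () renaming (_≤_ to _≤ₜ_)
  open NaturalOrder _≈_ _⊗_ public using () renaming (_≤_ to _≤ₖ_)

record IsBilattice (A : Algebra c ℓ) : Set (c ⊔ ℓ) where
  open Algebra A
  field
    isLatticeₜ   : IsLattice _≈_ _∨_ _∧_
    isLatticeₖ   : IsLattice _≈_ _⊕_ _⊗_
    ¬-antitone   : ∀ a b → a ≤ₜ b → ¬ b ≤ₜ ¬ a
    ¬-monotone   : ∀ a b → a ≤ₖ b → ¬ a ≤ₖ ¬ b
    ¬-involutive : ∀ a → ¬ ¬ a ≈ a

data LatticeOp : Set where
  meetₜ joinₜ meetₖ joinₖ : LatticeOp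

latticeOp : (A : Algebra c ℓ) → LatticeOp → Op₂ (Algebra.Carrier A)
latticeOp A meetₜ = Algebra._∧_ A
latticeOp A joinₜ = Algebra._∨_ A
latticeOp A meetₖ = Algebra._⊗_ A
latticeOp A joinₖ = Algebra._⊕_ A

record IsDistributiveBilattice (A : Algebra c ℓ) : Set (c ⊔ ℓ) where
  open Algebra A using (_≈_)
  field
    isBilattice : IsBilattice A
    distrib     : ∀ ∘ ∙ → ∘ ≢ ∙ →
                  _DistributesOverˡ_ _≈_ (latticeOp A ∘) (latticeOp A ∙)

DBiLat : ∀ {c ℓ} → Pred (Algebra c ℓ) (c ⊔ ℓ)
DBiLat = IsDistributiveBilattice

------------------------------------------------------------------------
-- Formulas, equations and equational consequence

infix  9 ¬_
infixr 8 _⊗_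
infixr 7 _∧_ _⊕_
infixr 6 _∨_

data Formula : Set where
  var             : ℕ → Formula
  _∧_ _∨_ _⊗_ _⊕_ : Formula → Formula → Formula
  ¬_              : Formula → Formula

infix 4 _≈_

data Equation : Set where
  _≈_ : Formula → Formula → Equation

module _ (A : Algebra c ℓ) where
  private module A = Algebra A

  ⟦_⟧ : Formula → (ℕ → A.Carrier) → A.Carrier
  ⟦ var x ⟧ h = h x
  ⟦ φ ∧ ψ ⟧ h = ⟦ φ ⟧ h A.∧ ⟦ ψ ⟧ h
  ⟦ φ ∨ ψ ⟧ h = ⟦ φ ⟧ h A.∨ ⟦ ψ ⟧ h
  ⟦ φ ⊗ ψ ⟧ h = ⟦ φ ⟧ h A.⊗ ⟦ ψ ⟧ h
  ⟦ φ ⊕ ψ ⟧ h = ⟦ φ ⟧ h A.⊕ ⟦ ψ ⟧ h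
  ⟦ ¬ φ ⟧   h = A.¬ ⟦ φ ⟧ h

  Satisfies : (ℕ → A.Carrier) → Equation → Set ℓ
  Satisfies h (φ ≈ ψ) = ⟦ φ ⟧ h A.≈ ⟦ ψ ⟧ h

infix 3 _⊨[_]_

_⊨[_]_ : ∀ {c ℓ} → Pred Equation p → Pred (Algebra c ℓ) k → Pred Equation q →
         Set (lsuc (c ⊔ ℓ) ⊔ p ⊔ k ⊔ q)
E ⊨[ K ] E′ = ∀ A → A ∈ K → ∀ h →
              (∀ {e} → e ∈ E → Satisfies A h e) →
              (∀ {e} → e ∈ E′ → Satisfies A h e)

------------------------------------------------------------------------
-- Sequents and the calculus

-- A finite non-empty set is represented by a non-empty list of its
-- members; two lists represent the same set when they are related by
-- _∼[ set ]_, i.e. have the same members.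

infix 3 _▷_

data Sequent : Set where
  _▷_ : List⁺ Formula → List⁺ Formula → Sequent

infix 4 _≐_

_≐_ : Rel (List⁺ Formula) 0ℓ
Γ ≐ Δ = toList Γ ∼[ set ] toList Δ

private
  variable
    φ ψ         : Formula
    Γ Γ′ Δ Δ′     : List Formula
    Γ⁺ Γ⁺′ Δ⁺ Δ⁺′ : List⁺ Formula

-- Γ and Δ stand for possibly empty contexts, Γ⁺ and Δ⁺ for contexts that
-- must be non-empty because they are a whole side of a sequent.

infix 2 _∣∼_

data _∣∼_ (S : Pred Sequent p) : Sequent → Set p where
  hyp  : ∀ {s} → s ∈ S → S ∣∼ s

  -- Not an inference step of the calculus: identifies the different
  -- presentations of one sequent, a pair of sets.
  resp : Γ⁺ ≐ Γ⁺′ → Δ⁺ ≐ Δ⁺′ → S ∣∼ Γ⁺ ▷ Δ⁺ → S ∣∼ Γ⁺′ ▷ Δ⁺′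

  ax   : S ∣∼ φ ∷ Γ ▷ φ ∷ Δ

  -- The context-sharing form is the instance in which both premises have
  -- the same contexts, since duplicates are identified by resp.
  cut  : S ∣∼ Γ⁺ ▷ φ ∷ Δ → S ∣∼ φ ∷ Γ′ ▷ Δ⁺′ → S ∣∼ Γ⁺ ⁺++ Γ′ ▷ Δ ++⁺ Δ⁺′

  ∧▷   : S ∣∼ φ ∷ ψ ∷ Γ ▷ Δ⁺ → S ∣∼ φ ∧ ψ ∷ Γ ▷ Δ⁺
  ▷∧   : S ∣∼ Γ⁺ ▷ φ ∷ Δ → S ∣∼ Γ⁺ ▷ ψ ∷ Δ → S ∣∼ Γ⁺ ▷ φ ∧ ψ ∷ Δ
  ¬∧▷  : S ∣∼ ¬ φ ∷ Γ ▷ Δ⁺ → S ∣∼ ¬ ψ ∷ Γ ▷ Δ⁺ → S ∣∼ ¬ (φ ∧ ψ) ∷ Γ ▷ Δ⁺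
  ▷¬∧  : S ∣∼ Γ⁺ ▷ ¬ φ ∷ ¬ ψ ∷ Δ → S ∣∼ Γ⁺ ▷ ¬ (φ ∧ ψ) ∷ Δ

  ∨▷   : S ∣∼ φ ∷ Γ ▷ Δ⁺ → S ∣∼ ψ ∷ Γ ▷ Δ⁺ → S ∣∼ φ ∨ ψ ∷ Γ ▷ Δ⁺
  ▷∨   : S ∣∼ Γ⁺ ▷ φ ∷ ψ ∷ Δ → S ∣∼ Γ⁺ ▷ φ ∨ ψ ∷ Δ
  ¬∨▷  : S ∣∼ ¬ φ ∷ ¬ ψ ∷ Γ ▷ Δ⁺ → S ∣∼ ¬ (φ ∨ ψ) ∷ Γ ▷ Δ⁺
  ▷¬∨  : S ∣∼ Γ⁺ ▷ ¬ φ ∷ Δ → S ∣∼ Γ⁺ ▷ ¬ ψ ∷ Δ → S ∣∼ Γ⁺ ▷ ¬ (φ ∨ ψ) ∷ Δ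

  ⊗▷   : S ∣∼ φ ∷ ψ ∷ Γ ▷ Δ⁺ → S ∣∼ φ ⊗ ψ ∷ Γ ▷ Δ⁺
  ▷⊗   : S ∣∼ Γ⁺ ▷ φ ∷ Δ → S ∣∼ Γ⁺ ▷ ψ ∷ Δ → S ∣∼ Γ⁺ ▷ φ ⊗ ψ ∷ Δ
  ¬⊗▷  : S ∣∼ ¬ φ ∷ ¬ ψ ∷ Γ ▷ Δ⁺ → S ∣∼ ¬ (φ ⊗ ψ) ∷ Γ ▷ Δ⁺
  ▷¬⊗  : S ∣∼ Γ⁺ ▷ ¬ φ ∷ Δ → S ∣∼ Γ⁺ ▷ ¬ ψ ∷ Δ → S ∣∼ Γ⁺ ▷ ¬ (φ ⊗ ψ) ∷ Δ

  ⊕▷   : S ∣∼ φ ∷ Γ ▷ Δ⁺ → S ∣∼ ψ ∷ Γ ▷ Δ⁺ → S ∣∼ φ ⊕ ψ ∷ Γ ▷ Δ⁺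
  ▷⊕   : S ∣∼ Γ⁺ ▷ φ ∷ ψ ∷ Δ → S ∣∼ Γ⁺ ▷ φ ⊕ ψ ∷ Δ
  ¬⊕▷  : S ∣∼ ¬ φ ∷ Γ ▷ Δ⁺ → S ∣∼ ¬ ψ ∷ Γ ▷ Δ⁺ → S ∣∼ ¬ (φ ⊕ ψ) ∷ Γ ▷ Δ⁺
  ▷¬⊕  : S ∣∼ Γ⁺ ▷ ¬ φ ∷ ¬ ψ ∷ Δ → S ∣∼ Γ⁺ ▷ ¬ (φ ⊕ ψ) ∷ Δ

  ¬¬▷  : S ∣∼ φ ∷ Γ ▷ Δ⁺ → S ∣∼ ¬ ¬ φ ∷ Γ ▷ Δ⁺
  ▷¬¬  : S ∣∼ Γ⁺ ▷ φ ∷ Δ → S ∣∼ Γ⁺ ▷ ¬ ¬ φ ∷ Δ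

------------------------------------------------------------------------
-- Algebraizability

members : {A : Set} → List A → Pred A 0ℓ
members xs x = x ∈ˡ xs

⋃ : {A B : Set} → Pred A p → (A → List B) → Pred B p
⋃ S f y = ∃ λ x → x ∈ S × y ∈ˡ f x

-- The sets S live at the level ℓ of the equality of the algebras in K, so
-- that S-interderivability of formulas can be the equality of an algebra.

record Algebraizable {c ℓ k} (K : Pred (Algebra c ℓ) k)
                     (τ : Sequent → List Equation)
                     (ρ : Equation → List Sequent) :
                     Set (lsuc (c ⊔ ℓ) ⊔ k) where
  field
    faithful : ∀ (S : Pred Sequent ℓ) s →
               (S ∣∼ s) ⇔ (⋃ S τ ⊨[ K ] members (τ s))
    inverse  : ∀ e →
               (｛ e ｝ ⊨[ K ] ⋃ (members (ρ e)) τ) ×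
               (⋃ (members (ρ e)) τ ⊨[ K ] ｛ e ｝)

-- The order of the conjunction or disjunction is that of the list; since
-- sequents are arbitrary lists, every choice of order is covered.

⋀ ⋁ : List⁺ Formula → Formula
⋀ = foldr₁ _∧_
⋁ = foldr₁ _∨_

τ : Sequent → List Equation
τ (Γ ▷ Δ) = (⋀ Γ ∧ (⋀ Γ ⊗ ⋁ Δ) ≈ ⋀ Γ) ∷ []

ρ : Equation → List Sequent
ρ (φ ≈ ψ) = ([ φ ]   ▷ [ ψ ])
          ∷ ([ ¬ φ ] ▷ [ ¬ ψ ])
          ∷ ([ ψ ]   ▷ [ φ ])
          ∷ ([ ¬ ψ ] ▷ [ ¬ φ ])
          ∷ []

{-# OPTIONS --safe #-}

-- In a distributive bilattice, the relation "x ≤ₜ x ⊗ y" is a preorder whose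
-- quotient is a distributive lattice in which ∧ and ⊗ are both the meet and ∨
-- and ⊕ are both the join; classically it compares the first coordinates of
-- x and y in a representation of the bilattice as a product L ⊙ L.  A sequent
-- Γ ▷ Δ says that ⋀ Γ is below ⋁ Δ in this preorder, so the rules of the
-- calculus are the usual ones for distributive lattices, applied to literals
-- pushed through ¬ by the De Morgan laws.  For completeness, interderivability
-- from S makes the formulas a distributive lattice L; in L ⊙ L, under the
-- valuation x ↦ (x , ¬ x), every formula φ has the value (φ , ¬ φ).

module Submission where

open import Defs hiding (_∧_; _∨_; _⊗_; _⊕_; ¬_; _≈_)

open import Algebra.Core using (Op₂)
open import Algebra.Definitions using (_DistributesOverˡ_)
import Algebra.Lattice.Bundles as AlgLattice
import Algebra.Lattice.Properties.Lattice as AlgLatticeProperties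
import Algebra.Lattice.Structures as AlgStructures
open import Data.List.Base using (List; []; _∷_; _++_)
open import Data.List.Membership.Propositional.Properties using (∈-++⁻; ∈-++⁺ˡ; ∈-++⁺ʳ)
open import Data.List.NonEmpty.Base using (List⁺; _∷_; _++⁺_; [_]; toList)
open import Data.List.Relation.Binary.BagAndSetEquality using (_∼[_]_; set)
open import Data.List.Relation.Binary.Permutation.Propositional using (↭-swap; ↭-refl; ↭-sym)
open import Data.List.Relation.Binary.Permutation.Propositional.Properties using (shift)
open import Data.List.Relation.Binary.Subset.Propositional using (_⊆_)
open import Data.List.Relation.Binary.Subset.Propositional.Properties
  using (All-resp-⊇; ⊆-reflexive-↭)
open import Data.List.Relation.Unary.All as All using (All; []; _∷_)
open import Data.List.Relation.Unary.All.Properties using (++⁻ˡ; ++⁻ʳ)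
open import Data.List.Relation.Unary.Any using (here; there)
open import Data.Nat.Base using (ℕ)
open import Data.Product.Base using (_×_; _,_; proj₁; proj₂; zip; swap)
open import Data.Product.Relation.Binary.Pointwise.NonDependent
  using (Pointwise; ×-isEquivalence)
open import Data.Sum.Base using ([_,_]′)
open import Function.Base using (id; _∘_; _on_)
open import Function.Bundles using (_⇔_; mk⇔; Equivalence)
open import Level using (Level; Lift; lift; lower)
open import Relation.Binary.Construct.Interior.Symmetric as Interior
  using (SymInterior; _,_)
open import Relation.Binary.Core using (Rel)
open import Relation.Binary.Lattice using (Lattice; DistributiveLattice)
open import Relation.Binary.PropositionalEquality.Core as ≡ using (_≡_; _≢_)
import Relation.Binary.Lattice.Properties.DistributiveLattice as DistributiveProperties
import Relation.Binary.Lattice.Properties.JoinSemilattice as JoinProperties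
import Relation.Binary.Lattice.Properties.Lattice as LatticeProperties
import Relation.Binary.Lattice.Properties.MeetSemilattice as MeetProperties
open import Relation.Unary using (Pred; _∈_; ｛_｝)

private
  variable
    a b c ℓ ℓ₁ ℓ₂ p : Level

-- Sequents over a distributive lattice

module LatticeSemantics (L : DistributiveLattice c ℓ₁ ℓ₂) {A : Set a}
                        (v : A → DistributiveLattice.Carrier L) where
  open DistributiveLattice L
  open DistributiveProperties L using (∨-distribˡ-∧)

  -- For Γ and Δ non-empty this says ⋀ Γ ≤ ⋁ Δ; quantifying over bounds makes
  -- it independent of the order of the members and meaningful without bounds
  -- in the lattice.
  infix 3 _⊢_
  _⊢_ : List A → List A → Set _
  Γ ⊢ Δ = ∀ x y → All (λ γ → x ≤ v γ) Γ → All (λ δ → v δ ≤ y) Δ → x ≤ y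

  private
    variable
      φ ψ χ     : A
      Γ Γ′ Δ Δ′ : List A

  ⊢-resp-⊆ : Γ ⊆ Γ′ → Δ ⊆ Δ′ → Γ ⊢ Δ → Γ′ ⊢ Δ′
  ⊢-resp-⊆ Γ⊆ Δ⊆ d x y x≤ ≤y = d x y (All-resp-⊇ Γ⊆ x≤) (All-resp-⊇ Δ⊆ ≤y)

  axiom : φ ∷ Γ ⊢ φ ∷ Δ
  axiom x y (x≤φ ∷ _) (φ≤y ∷ _) = trans x≤φ φ≤y

  -- The bounds absorb the cut formula: the first premise is used with upper bound `y ∨ v φ`, the
  -- second with lower bound `x ∧ v φ`. Distributivity combines `x ≤ y ∨ v φ` and `x ∧ v φ ≤ y` into
  -- `x ≤ y`.
  ⊢-cut : Γ ⊢ φ ∷ Δ → φ ∷ Γ′ ⊢ Δ′ → Γ ++ Γ′ ⊢ Δ ++ Δ′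
  ⊢-cut {Γ = Γ} {φ = φ} {Δ = Δ} d e x y x≤ ≤y =
    trans (∧-greatest refl x≤y∨φ)
      (trans (reflexive (∧-distribˡ-∨ x y (v φ))) (∨-least (x∧y≤y x y) x∧φ≤y))
    where
    x≤y∨φ = d x (y ∨ v φ) (++⁻ˡ Γ x≤)
      (y≤x∨y y (v φ) ∷ All.map (λ δ≤y → trans δ≤y (x≤x∨y y (v φ))) (++⁻ˡ Δ ≤y))
    x∧φ≤y = e (x ∧ v φ) y
      (x∧y≤y x (v φ) ∷ All.map (trans (x∧y≤x x (v φ))) (++⁻ʳ Γ x≤)) (++⁻ʳ Δ ≤y)

  -- In this rule and those below, `χ` need only satisfy the inequalities that the rule uses, so one
  -- rule serves several connectives and their negations.
  monoˡ : v χ ≤ v φ → φ ∷ Γ ⊢ Δ → χ ∷ Γ ⊢ Δ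
  monoˡ χ≤φ d x y (x≤χ ∷ x≤) = d x y (trans x≤χ χ≤φ ∷ x≤)

  monoʳ : v φ ≤ v χ → Γ ⊢ φ ∷ Δ → Γ ⊢ χ ∷ Δ
  monoʳ φ≤χ d x y x≤ (χ≤y ∷ ≤y) = d x y x≤ (trans φ≤χ χ≤y ∷ ≤y)

  meetˡ : v χ ≤ v φ → v χ ≤ v ψ → φ ∷ ψ ∷ Γ ⊢ Δ → χ ∷ Γ ⊢ Δ
  meetˡ χ≤φ χ≤ψ d x y (x≤χ ∷ x≤) = d x y (trans x≤χ χ≤φ ∷ trans x≤χ χ≤ψ ∷ x≤)

  joinʳ : v φ ≤ v χ → v ψ ≤ v χ → Γ ⊢ φ ∷ ψ ∷ Δ → Γ ⊢ χ ∷ Δ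
  joinʳ φ≤χ ψ≤χ d x y x≤ (χ≤y ∷ ≤y) = d x y x≤ (trans φ≤χ χ≤y ∷ trans ψ≤χ χ≤y ∷ ≤y)

  -- The premises apply at the lower bounds `x ∧ v φ` and `x ∧ v ψ`, and distributivity joins the
  -- results; `meetʳ` is dual, with the bound `y` raised.
  joinˡ : v χ ≤ v φ ∨ v ψ → φ ∷ Γ ⊢ Δ → ψ ∷ Γ ⊢ Δ → χ ∷ Γ ⊢ Δ
  joinˡ {φ = φ} {ψ = ψ} χ≤φ∨ψ d e x y (x≤χ ∷ x≤) ≤y =
    trans (∧-greatest refl (trans x≤χ χ≤φ∨ψ))
      (trans (reflexive (∧-distribˡ-∨ x (v φ) (v ψ))) (∨-least (below d) (below e)))
    where
    below : ∀ {θ} → θ ∷ _ ⊢ _ → x ∧ v θ ≤ y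
    below {θ} d = d (x ∧ v θ) y (x∧y≤y x (v θ) ∷ All.map (trans (x∧y≤x x (v θ))) x≤) ≤y

  meetʳ : v φ ∧ v ψ ≤ v χ → Γ ⊢ φ ∷ Δ → Γ ⊢ ψ ∷ Δ → Γ ⊢ χ ∷ Δ
  meetʳ {φ = φ} {ψ = ψ} φ∧ψ≤χ d e x y x≤ (χ≤y ∷ ≤y) =
    trans (∧-greatest (above d) (above e))
      (trans (reflexive (Eq.sym (∨-distribˡ-∧ y (v φ) (v ψ))))
             (∨-least refl (trans φ∧ψ≤χ χ≤y)))
    where
    above : ∀ {θ} → _ ⊢ θ ∷ _ → x ≤ y ∨ v θ
    above {θ} d = d x (y ∨ v θ) x≤
      (y≤x∨y y (v θ) ∷ All.map (λ δ≤y → trans δ≤y (x≤x∨y y (v θ))) ≤y)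

-- Distributive bilattices

module DistributiveBilattice {A : Algebra c ℓ} (isDBL : DBiLat A) where
  open Algebra A
  open IsDistributiveBilattice isDBL
  open IsBilattice isBilattice

  latticeₜ latticeₖ : AlgLattice.Lattice c ℓ
  latticeₜ = record { isLattice = isLatticeₜ }
  latticeₖ = record { isLattice = isLatticeₖ }

  module T where
    open AlgLatticeProperties latticeₜ public
      using (∧-idem; ∨-∧-orderTheoreticLattice)
    open Lattice ∨-∧-orderTheoreticLattice public

  module K where
    open AlgLattice.Lattice latticeₖ public using (∧-comm; ∨-comm)
    open AlgLatticeProperties latticeₖ public
      using (∧-idem; ∨-idem; ∨-∧-orderTheoreticLattice)
    open Lattice ∨-∧-orderTheoreticLattice public
    open MeetProperties meetSemilattice public using (∧-monotonic)

  open T.Eq using (sym; trans) renaming (refl to ≈-refl)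

  -- `x ≤ₜ y` is the equation `x ≈ x ∧ y`; applying the operation with `z` to both sides and
  -- distributing it over `∧` gives the result.
  ∘-monoₜ : ∀ o → o ≢ meetₜ → ∀ z {x y} → x ≤ₜ y → latticeOp A o z x ≤ₜ latticeOp A o z y
  ∘-monoₜ o o≢∧ z {x} {y} x≤y = trans (congˡ o x≤y) (distrib o meetₜ o≢∧ z x y)
    where
    congˡ : ∀ o {u w} → u ≈ w → latticeOp A o z u ≈ latticeOp A o z w
    congˡ meetₜ = ∧-cong ≈-refl
    congˡ joinₜ = ∨-cong ≈-refl
    congˡ meetₖ = ⊗-cong ≈-refl
    congˡ joinₖ = ⊕-cong ≈-refl

  ⊗-monoₜ : ∀ {x y u w} → x ≤ₜ y → u ≤ₜ w → x ⊗ u ≤ₜ y ⊗ w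
  ⊗-monoₜ {x} {y} {u} {w} x≤y u≤w = T.trans (∘-monoₜ meetₖ (λ ()) x u≤w)
    (T.trans (T.reflexive (K.∧-comm x w))
      (T.trans (∘-monoₜ meetₖ (λ ()) w x≤y) (T.reflexive (K.∧-comm w y))))

  ⊕-monoₜ : ∀ {x y u w} → x ≤ₜ y → u ≤ₜ w → x ⊕ u ≤ₜ y ⊕ w
  ⊕-monoₜ {x} {y} {u} {w} x≤y u≤w = T.trans (∘-monoₜ joinₖ (λ ()) x u≤w)
    (T.trans (T.reflexive (K.∨-comm x w))
      (T.trans (∘-monoₜ joinₖ (λ ()) w x≤y) (T.reflexive (K.∨-comm w y))))

  ∧-monoʳₖ : ∀ z {x y} → x ≤ₖ y → z ∧ x ≤ₖ z ∧ y
  ∧-monoʳₖ z {x} {y} x≤y = trans (∧-cong ≈-refl x≤y) (distrib meetₜ meetₖ (λ ()) z x y)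

  infix 4 _⊑_
  _⊑_ : Rel Carrier ℓ
  x ⊑ y = x ≤ₜ x ⊗ y

  ≤ₜ⇒⊑ : ∀ {x y} → x ≤ₜ y → x ⊑ y
  ≤ₜ⇒⊑ {x} x≤y = T.trans (T.reflexive (sym (K.∧-idem x))) (⊗-monoₜ T.refl x≤y)

  ≤ₖ⇒⊑ : ∀ {x y} → x ≤ₖ y → x ⊑ y
  ≤ₖ⇒⊑ = T.reflexive

  ≈⇒⊑ : ∀ {x y} → x ≈ y → x ⊑ y
  ≈⇒⊑ = ≤ₜ⇒⊑ ∘ T.reflexive

  ⊑-refl : ∀ {x} → x ⊑ x
  ⊑-refl = ≈⇒⊑ ≈-refl

  -- x ≤ₜ x ⊗ (y ⊗ z), and x ⊗ z lies ≤ₖ-between x ⊗ (y ⊗ z) and x; meeting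
  -- with x collapses this interval to x.
  ⊑-trans : ∀ {x y z} → x ⊑ y → y ⊑ z → x ⊑ z
  ⊑-trans {x} {y} {z} x⊑y y⊑z = K.antisym
    (K.trans (K.reflexive x≤x⊗y⊗z) (∧-monoʳₖ x (K.∧-monotonic K.refl (K.x∧y≤y y z))))
    (K.trans (∧-monoʳₖ x (K.x∧y≤x x z)) (K.reflexive (T.∧-idem x)))
    where
    x≤x⊗y⊗z : x ≤ₜ x ⊗ (y ⊗ z)
    x≤x⊗y⊗z = T.trans x⊑y (⊗-monoₜ T.refl y⊑z)

  ∧-greatest : ∀ {x y z} → x ⊑ y → x ⊑ z → x ⊑ y ∧ z
  ∧-greatest {x} {y} {z} x⊑y x⊑z =
    T.trans (T.∧-greatest x⊑y x⊑z) (T.reflexive (sym (distrib meetₖ meetₜ (λ ()) x y z)))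

  ∨-least : ∀ {x y z} → x ⊑ z → y ⊑ z → x ∨ y ⊑ z
  ∨-least {x} {y} x⊑z y⊑z = T.∨-least
    (T.trans x⊑z (⊗-monoₜ (T.x≤x∨y x y) T.refl))
    (T.trans y⊑z (⊗-monoₜ (T.y≤x∨y x y) T.refl))

  -- By idempotence of `⊗` and `⊗-monoₜ`. As `x ⊗ y` is `≤ₖ`-below both factors, `⊗` is thus a meet
  -- for `⊑` as well; `⊕⊑∨` is the dual fact.
  ∧⊑⊗ : ∀ x y → x ∧ y ⊑ x ⊗ y
  ∧⊑⊗ x y = ≤ₜ⇒⊑ (T.trans (T.reflexive (sym (K.∧-idem (x ∧ y))))
                           (⊗-monoₜ (T.x∧y≤x x y) (T.x∧y≤y x y)))

  ⊕⊑∨ : ∀ x y → x ⊕ y ⊑ x ∨ y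
  ⊕⊑∨ x y = ≤ₜ⇒⊑ (T.trans (⊕-monoₜ (T.x≤x∨y x y) (T.y≤x∨y x y))
                           (T.reflexive (K.∨-idem (x ∨ y))))

  truthLattice : DistributiveLattice c ℓ ℓ
  truthLattice = record
    { _≈_ = SymInterior _⊑_
    ; _≤_ = _⊑_
    ; _∨_ = _∨_
    ; _∧_ = _∧_
    ; isDistributiveLattice = record
      { isLattice = record
        { isPartialOrder = Interior.isPartialOrder ⊑-refl ⊑-trans
        ; supremum = λ x y → ≤ₜ⇒⊑ (T.x≤x∨y x y) , ≤ₜ⇒⊑ (T.y≤x∨y x y) , λ z → ∨-least
        ; infimum = λ x y → ≤ₜ⇒⊑ (T.x∧y≤x x y) , ≤ₜ⇒⊑ (T.x∧y≤y x y) , λ z → ∧-greatest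
        }
      ; ∧-distribˡ-∨ = λ x y z →
          let eq = distrib meetₜ joinₜ (λ ()) x y z in ≈⇒⊑ eq , ≈⇒⊑ (sym eq)
      }
    }

  -- De Morgan laws, and equality from `⊑`

  ¬-galoisₜ : ∀ {x y} → ¬ x ≤ₜ y → ¬ y ≤ₜ x
  ¬-galoisₜ {x} ¬x≤y = T.trans (¬-antitone _ _ ¬x≤y) (T.reflexive (¬-involutive x))

  -- For each De Morgan law, the half that needs involutivity is stated here and below; the other
  -- half follows at once from `¬-antitone` or `¬-monotone`.
  ¬[x∧y]≤¬x∨¬y : ∀ x y → ¬ (x ∧ y) ≤ₜ ¬ x ∨ ¬ y
  ¬[x∧y]≤¬x∨¬y x y = ¬-galoisₜ
    (T.∧-greatest (¬-galoisₜ (T.x≤x∨y (¬ x) (¬ y))) (¬-galoisₜ (T.y≤x∨y (¬ x) (¬ y))))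

  ¬x∧¬y≤¬[x∨y] : ∀ x y → ¬ x ∧ ¬ y ≤ₜ ¬ (x ∨ y)
  ¬x∧¬y≤¬[x∨y] x y = T.trans (T.reflexive (sym (¬-involutive (¬ x ∧ ¬ y))))
    (¬-antitone _ _ (T.∨-least (step (T.x∧y≤x (¬ x) (¬ y))) (step (T.x∧y≤y (¬ x) (¬ y)))))
    where
    step : ∀ {u w} → u ≤ₜ ¬ w → w ≤ₜ ¬ u
    step {u} {w} u≤¬w = T.trans (T.reflexive (sym (¬-involutive w))) (¬-antitone _ _ u≤¬w)

  ¬x⊗¬y≤¬[x⊗y] : ∀ x y → ¬ x ⊗ ¬ y ≤ₖ ¬ (x ⊗ y)
  ¬x⊗¬y≤¬[x⊗y] x y = K.trans (K.reflexive (sym (¬-involutive (¬ x ⊗ ¬ y))))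
    (¬-monotone _ _ (K.∧-greatest (step (K.x∧y≤x (¬ x) (¬ y))) (step (K.x∧y≤y (¬ x) (¬ y)))))
    where
    step : ∀ {u w} → u ≤ₖ ¬ w → ¬ u ≤ₖ w
    step {u} {w} u≤¬w = K.trans (¬-monotone _ _ u≤¬w) (K.reflexive (¬-involutive w))

  ¬[x⊕y]≤¬x⊕¬y : ∀ x y → ¬ (x ⊕ y) ≤ₖ ¬ x ⊕ ¬ y
  ¬[x⊕y]≤¬x⊕¬y x y = K.trans
    (¬-monotone _ _ (K.∨-least (step (K.x≤x∨y (¬ x) (¬ y))) (step (K.y≤x∨y (¬ x) (¬ y)))))
    (K.reflexive (¬-involutive (¬ x ⊕ ¬ y)))
    where
    step : ∀ {u w} → ¬ u ≤ₖ w → u ≤ₖ ¬ w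
    step {u} ¬u≤w = K.trans (K.reflexive (sym (¬-involutive u))) (¬-monotone _ _ ¬u≤w)

  ¬⊗ : ∀ x y → ¬ (x ⊗ y) ≈ ¬ x ⊗ ¬ y
  ¬⊗ x y = K.antisym
    (K.∧-greatest (¬-monotone _ _ (K.x∧y≤x x y)) (¬-monotone _ _ (K.x∧y≤y x y)))
    (¬x⊗¬y≤¬[x⊗y] x y)

  -- ¬ x ⊑ ¬ y gives x ⊗ y ≤ₜ x, because ¬ commutes with ⊗ and reverses ≤ₜ.
  x≈x⊗y : ∀ {x y} → x ⊑ y → ¬ x ⊑ ¬ y → x ≈ x ⊗ y
  x≈x⊗y {x} {y} x⊑y ¬x⊑¬y = T.antisym x⊑y
    (T.trans (T.reflexive (sym (¬-involutive (x ⊗ y))))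
      (¬-galoisₜ (T.trans ¬x⊑¬y (T.reflexive (sym (¬⊗ x y))))))

  -- The hypotheses are what the four sequents of `ρ` express; they yield `x ≤ₖ y` and `y ≤ₖ x`.
  ⊑-antisym : ∀ {x y} → x ⊑ y → y ⊑ x → ¬ x ⊑ ¬ y → ¬ y ⊑ ¬ x → x ≈ y
  ⊑-antisym x⊑y y⊑x ¬x⊑¬y ¬y⊑¬x = K.antisym (x≈x⊗y x⊑y ¬x⊑¬y) (x≈x⊗y y⊑x ¬y⊑¬x)

-- The bilattice L ⊙ L

module _ {A : Set a} {B : Set b} {_≈₁_ : Rel A ℓ₁} {_≈₂_ : Rel B ℓ₂}
         {∨₁ ∧₁ : Op₂ A} {∨₂ ∧₂ : Op₂ B} where

  ×-isLattice : AlgStructures.IsLattice _≈₁_ ∨₁ ∧₁ → AlgStructures.IsLattice _≈₂_ ∨₂ ∧₂ →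
                AlgStructures.IsLattice (Pointwise _≈₁_ _≈₂_) (zip ∨₁ ∨₂) (zip ∧₁ ∧₂)
  ×-isLattice L M = record
    { isEquivalence = ×-isEquivalence L.isEquivalence M.isEquivalence
    ; ∨-comm = λ (x , x′) (y , y′) → L.∨-comm x y , M.∨-comm x′ y′
    ; ∨-assoc = λ (x , x′) (y , y′) (z , z′) → L.∨-assoc x y z , M.∨-assoc x′ y′ z′
    ; ∨-cong = zip L.∨-cong M.∨-cong
    ; ∧-comm = λ (x , x′) (y , y′) → L.∧-comm x y , M.∧-comm x′ y′
    ; ∧-assoc = λ (x , x′) (y , y′) (z , z′) → L.∧-assoc x y z , M.∧-assoc x′ y′ z′
    ; ∧-cong = zip L.∧-cong M.∧-cong
    ; absorptive = (λ (x , x′) (y , y′) → L.∨-absorbs-∧ x y , M.∨-absorbs-∧ x′ y′)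
                 , (λ (x , x′) (y , y′) → L.∧-absorbs-∨ x y , M.∧-absorbs-∨ x′ y′)
    }
    where
    module L = AlgStructures.IsLattice L
    module M = AlgStructures.IsLattice M

module ProductBilattice (L : DistributiveLattice c ℓ₁ ℓ₂) where
  open DistributiveLattice L hiding (isLattice)
  open DistributiveProperties L using (∨-distribˡ-∧)
  open JoinProperties joinSemilattice using (∨-cong; ∨-monotonic)
  open MeetProperties meetSemilattice using (∧-cong; ∧-comm; ∧-monotonic)
  open LatticeProperties lattice

  -- `≤ₜ` reverses the order of `L` in the second coordinate and `≤ₖ` keeps it in both, so `swap`
  -- reverses the former and preserves the latter.
  algebra : Algebra c ℓ₁
  algebra = record
    { _≈_ = Pointwise _≈_ _≈_
    ; isEquivalence = ×-isEquivalence isEquivalence isEquivalence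
    ; _∧_ = zip _∧_ _∨_
    ; _∨_ = zip _∨_ _∧_
    ; _⊗_ = zip _∧_ _∧_
    ; _⊕_ = zip _∨_ _∨_
    ; ¬_ = swap
    ; ∧-cong = zip ∧-cong ∨-cong
    ; ∨-cong = zip ∨-cong ∧-cong
    ; ⊗-cong = zip ∧-cong ∧-cong
    ; ⊕-cong = zip ∨-cong ∨-cong
    ; ¬-cong = swap
    }

  data MeetOrJoin : Set where
    meet join : MeetOrJoin

  op : MeetOrJoin → Op₂ Carrier
  op meet = _∧_
  op join = _∨_

  coordinate₁ coordinate₂ : LatticeOp → MeetOrJoin
  coordinate₁ meetₜ = meet
  coordinate₁ joinₜ = join
  coordinate₁ meetₖ = meet
  coordinate₁ joinₖ = join
  coordinate₂ meetₜ = join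
  coordinate₂ joinₜ = meet
  coordinate₂ meetₖ = meet
  coordinate₂ joinₖ = join

  -- Splitting every operation into its coordinates reduces all the distributive laws to the four
  -- cases of `op-distribˡ`.
  latticeOp≡zip : ∀ o → latticeOp algebra o ≡ zip (op (coordinate₁ o)) (op (coordinate₂ o))
  latticeOp≡zip meetₜ = ≡.refl
  latticeOp≡zip joinₜ = ≡.refl
  latticeOp≡zip meetₖ = ≡.refl
  latticeOp≡zip joinₖ = ≡.refl

  -- The cases o = m arise because distinct operations of L ⊙ L can agree in
  -- one coordinate.
  op-distribˡ : ∀ o m → _DistributesOverˡ_ _≈_ (op o) (op m)
  op-distribˡ meet join = ∧-distribˡ-∨
  op-distribˡ join meet = ∨-distribˡ-∧
  op-distribˡ meet meet x y z = antisym
    (∧-greatest (∧-monotonic refl (x∧y≤x y z)) (∧-monotonic refl (x∧y≤y y z)))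
    (∧-greatest (trans (x∧y≤x _ _) (x∧y≤x x y)) (∧-monotonic (x∧y≤y x y) (x∧y≤y x z)))
  op-distribˡ join join x y z = antisym
    (∨-least (trans (x≤x∨y x y) (x≤x∨y _ _)) (∨-monotonic (y≤x∨y x y) (y≤x∨y x z)))
    (∨-least (∨-monotonic refl (x≤x∨y y z)) (∨-monotonic refl (y≤x∨y y z)))

  -- `≤ₜ` compares first coordinates through `∧` and second ones through `∨`. Since `swap` exchanges
  -- the coordinates, antitonicity of negation requires passing from one form to the other.
  x≈x∧y⇒y≈y∨x : ∀ {x y} → x ≈ x ∧ y → y ≈ y ∨ x
  x≈x∧y⇒y≈y∨x x≈x∧y = Eq.sym (quadrilateral₂ (Eq.trans (∧-comm _ _) (Eq.sym x≈x∧y)))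

  x≈x∨y⇒y≈y∧x : ∀ {x y} → x ≈ x ∨ y → y ≈ y ∧ x
  x≈x∨y⇒y≈y∧x x≈x∨y = Eq.sym (Eq.trans (∧-comm _ _) (quadrilateral₁ (Eq.sym x≈x∨y)))

  isDistributiveBilattice : DBiLat algebra
  isDistributiveBilattice = record
    { isBilattice = record
      { isLatticeₜ = ×-isLattice isAlgLattice (AlgLatticeProperties.∧-∨-isLattice algLattice)
      ; isLatticeₖ = ×-isLattice isAlgLattice isAlgLattice
      ; ¬-antitone = λ _ _ (x≤y , y′≤x′) → x≈x∨y⇒y≈y∧x y′≤x′ , x≈x∧y⇒y≈y∨x x≤y
      ; ¬-monotone = λ _ _ → swap
      ; ¬-involutive = λ _ → Eq.refl , Eq.refl
      }
    ; distrib = distrib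
    }
    where
    distrib : ∀ o m → o ≢ m →
              _DistributesOverˡ_ (Pointwise _≈_ _≈_) (latticeOp algebra o) (latticeOp algebra m)
    distrib o m _ (x , x′) (y , y′) (z , z′)
      rewrite latticeOp≡zip o | latticeOp≡zip m =
      op-distribˡ (coordinate₁ o) (coordinate₁ m) x y z ,
      op-distribˡ (coordinate₂ o) (coordinate₂ m) x′ y′ z′

  private module P = Algebra algebra

  -- In the second coordinate the equation is an instance of absorption, so the equation of `τ`
  -- constrains first coordinates only.
  ≤⇒x∧[x⊗y]≈x : ∀ {x y} → proj₁ x ≤ proj₁ y → x P.∧ (x P.⊗ y) P.≈ x
  ≤⇒x∧[x⊗y]≈x {x , x′} {y , y′} x≤y =
    antisym (x∧y≤x _ _) (∧-greatest refl (∧-greatest refl x≤y)) , ∨-absorbs-∧ x′ y′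

  x∧[x⊗y]≈x⇒≤ : ∀ {x y} → x P.∧ (x P.⊗ y) P.≈ x → proj₁ x ≤ proj₁ y
  x∧[x⊗y]≈x⇒≤ (eq , _) = trans (reflexive (Eq.sym eq)) (trans (x∧y≤y _ _) (x∧y≤y _ _))

open Defs using (_∧_; _∨_; _⊗_; _⊕_; ¬_; _≈_)

toList-++⁺ : {X : Set a} (xs : List X) (ys : List⁺ X) → toList (xs ++⁺ ys) ≡ xs ++ toList ys
toList-++⁺ []       ys = ≡.refl
toList-++⁺ (x ∷ xs) ys = ≡.cong (x ∷_) (toList-++⁺ xs ys)

-- Soundness

module Soundness {A : Algebra c ℓ} (isDBL : DBiLat A) (h : ℕ → Algebra.Carrier A) where
  private
    module A = Algebra A
  open DistributiveBilattice isDBL public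
  open IsBilattice (IsDistributiveBilattice.isBilattice isDBL)
  private
    module L = DistributiveLattice truthLattice

  v : Formula → A.Carrier
  v φ = ⟦ A ⟧ φ h

  open LatticeSemantics truthLattice v

  infix 2 ⊨_
  ⊨_ : Sequent → Set _
  ⊨ Γ ▷ Δ = toList Γ ⊢ toList Δ

  ⋀-greatest : ∀ Γ {x} → All (λ γ → x ⊑ v γ) (toList Γ) → x ⊑ v (⋀ Γ)
  ⋀-greatest (φ ∷ [])    (x≤φ ∷ [])  = x≤φ
  ⋀-greatest (φ ∷ ψ ∷ Γ) (x≤φ ∷ x≤Γ) = ∧-greatest x≤φ (⋀-greatest (ψ ∷ Γ) x≤Γ)

  ⋀-lower : ∀ φ Γ → All (λ γ → v (⋀ (φ ∷ Γ)) ⊑ v γ) (φ ∷ Γ)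
  ⋀-lower φ []      = L.refl ∷ []
  ⋀-lower φ (ψ ∷ Γ) =
    L.x∧y≤x _ _ ∷ All.map (L.trans (L.x∧y≤y _ _)) (⋀-lower ψ Γ)

  ⋁-least : ∀ Δ {y} → All (λ δ → v δ ⊑ y) (toList Δ) → v (⋁ Δ) ⊑ y
  ⋁-least (φ ∷ [])    (φ≤y ∷ [])  = φ≤y
  ⋁-least (φ ∷ ψ ∷ Δ) (φ≤y ∷ Δ≤y) = ∨-least φ≤y (⋁-least (ψ ∷ Δ) Δ≤y)

  ⋁-upper : ∀ φ Δ → All (λ δ → v δ ⊑ v (⋁ (φ ∷ Δ))) (φ ∷ Δ)
  ⋁-upper φ []      = L.refl ∷ []
  ⋁-upper φ (ψ ∷ Δ) =
    L.x≤x∨y _ _ ∷ All.map (λ δ≤ → L.trans δ≤ (L.y≤x∨y _ _)) (⋁-upper ψ Δ)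

  -- Read from right to left, the equation of `τ` is the unfolding of `⋀ Γ ⊑ ⋁ Δ`.
  satisfies⇒⊨ : ∀ s → (∀ {e} → e ∈ members (τ s) → Satisfies A h e) → ⊨ s
  satisfies⇒⊨ (Γ ▷ Δ) sat x y x≤Γ Δ≤y =
    L.trans (⋀-greatest Γ x≤Γ) (L.trans (T.Eq.sym (sat (here ≡.refl))) (⋁-least Δ Δ≤y))

  ⊨⇒satisfies : ∀ s → ⊨ s → ∀ {e} → e ∈ members (τ s) → Satisfies A h e
  ⊨⇒satisfies (φ ∷ Γ ▷ ψ ∷ Δ) d (here ≡.refl) = T.Eq.sym (d _ _ (⋀-lower φ Γ) (⋁-upper ψ Δ))

  sound : {S : Pred Sequent p} → (∀ {s} → s ∈ S → ⊨ s) → ∀ {s} → S ∣∼ s → ⊨ s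
  sound {S = S} S⊨ = go
    where
    go : ∀ {s} → S ∣∼ s → ⊨ s
    go (hyp s∈S) = S⊨ s∈S
    go (resp Γ≐ Δ≐ d) = ⊢-resp-⊆ (Equivalence.to Γ≐) (Equivalence.to Δ≐) (go d)
    go ax = axiom
    go (cut {Δ = Δ} {Δ⁺′ = Δ′} d e) = ≡.subst (_ ⊢_) (≡.sym (toList-++⁺ Δ Δ′)) (⊢-cut (go d) (go e))
    go (∧▷ d) = meetˡ (L.x∧y≤x _ _) (L.x∧y≤y _ _) (go d)
    go (▷∧ d e) = meetʳ L.refl (go d) (go e)
    go (¬∧▷ d e) = joinˡ (≤ₜ⇒⊑ (¬[x∧y]≤¬x∨¬y _ _)) (go d) (go e)
    go (▷¬∧ d) = joinʳ (≤ₜ⇒⊑ (¬-antitone _ _ (T.x∧y≤x _ _))) (≤ₜ⇒⊑ (¬-antitone _ _ (T.x∧y≤y _ _))) (go d)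
    go (∨▷ d e) = joinˡ L.refl (go d) (go e)
    go (▷∨ d) = joinʳ (L.x≤x∨y _ _) (L.y≤x∨y _ _) (go d)
    go (¬∨▷ d) = meetˡ (≤ₜ⇒⊑ (¬-antitone _ _ (T.x≤x∨y _ _))) (≤ₜ⇒⊑ (¬-antitone _ _ (T.y≤x∨y _ _))) (go d)
    go (▷¬∨ d e) = meetʳ (≤ₜ⇒⊑ (¬x∧¬y≤¬[x∨y] _ _)) (go d) (go e)
    go (⊗▷ d) = meetˡ (≤ₖ⇒⊑ (K.x∧y≤x _ _)) (≤ₖ⇒⊑ (K.x∧y≤y _ _)) (go d)
    go (▷⊗ d e) = meetʳ (∧⊑⊗ _ _) (go d) (go e)
    go (¬⊗▷ d) = meetˡ (≤ₖ⇒⊑ (¬-monotone _ _ (K.x∧y≤x _ _))) (≤ₖ⇒⊑ (¬-monotone _ _ (K.x∧y≤y _ _))) (go d)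
    go (▷¬⊗ d e) = meetʳ (L.trans (∧⊑⊗ _ _) (≤ₖ⇒⊑ (¬x⊗¬y≤¬[x⊗y] _ _))) (go d) (go e)
    go (⊕▷ d e) = joinˡ (⊕⊑∨ _ _) (go d) (go e)
    go (▷⊕ d) = joinʳ (≤ₖ⇒⊑ (K.x≤x∨y _ _)) (≤ₖ⇒⊑ (K.y≤x∨y _ _)) (go d)
    go (¬⊕▷ d e) = joinˡ (L.trans (≤ₖ⇒⊑ (¬[x⊕y]≤¬x⊕¬y _ _)) (⊕⊑∨ _ _)) (go d) (go e)
    go (▷¬⊕ d) = joinʳ (≤ₖ⇒⊑ (¬-monotone _ _ (K.x≤x∨y _ _))) (≤ₖ⇒⊑ (¬-monotone _ _ (K.y≤x∨y _ _))) (go d)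
    go (¬¬▷ d) = monoˡ (≈⇒⊑ (¬-involutive _)) (go d)
    go (▷¬¬ d) = monoʳ (≈⇒⊑ (T.Eq.sym (¬-involutive _))) (go d)

-- Completeness

module Derivability (S : Pred Sequent p) where
  private
    variable
      φ ψ : Formula
      Γ Δ : List Formula
      Γ⁺ Γ⁺′ Δ⁺ Δ⁺′ : List⁺ Formula

  ++-absorbs : {xs ys : List Formula} → xs ⊆ ys → xs ++ ys ∼[ set ] ys
  ++-absorbs {xs} xs⊆ys = mk⇔ ([ xs⊆ys , id ]′ ∘ ∈-++⁻ xs) (∈-++⁺ʳ xs)

  -- Cutting against an axiom on a formula of the succedent adds arbitrary
  -- formulas to both sides.
  thin : toList Γ⁺ ⊆ toList Γ⁺′ → toList Δ⁺ ⊆ toList Δ⁺′ → S ∣∼ Γ⁺ ▷ Δ⁺ → S ∣∼ Γ⁺′ ▷ Δ⁺′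
  thin {Δ⁺ = φ ∷ Δ} {Δ⁺′ = Δ⁺′} Γ⊆ Δ⊆ d =
    resp (++-absorbs Γ⊆)
         (≡.subst (_∼[ set ] toList Δ⁺′) (≡.sym (toList-++⁺ Δ _)) Δ-absorbs)
         (cut d (ax {φ = φ} {Δ = toList Δ⁺′}))
    where
    Δ-absorbs : Δ ++ φ ∷ toList Δ⁺′ ∼[ set ] toList Δ⁺′
    Δ-absorbs = mk⇔
      ([ Δ⊆ ∘ there , (λ { (here eq) → Δ⊆ (here eq) ; (there i) → i }) ]′ ∘ ∈-++⁻ Δ)
      (∈-++⁺ʳ Δ ∘ there)

  ax-∈ : φ ∈ members (toList Γ⁺) → φ ∈ members (toList Δ⁺) → S ∣∼ Γ⁺ ▷ Δ⁺
  ax-∈ {φ = φ} φ∈Γ φ∈Δ = thin {Γ⁺ = [ φ ]} {Δ⁺ = [ φ ]}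
    (λ { (here ≡.refl) → φ∈Γ }) (λ { (here ≡.refl) → φ∈Δ }) ax

  exchangeˡ : S ∣∼ φ ∷ ψ ∷ Γ ▷ Δ⁺ → S ∣∼ ψ ∷ φ ∷ Γ ▷ Δ⁺
  exchangeˡ = thin (⊆-reflexive-↭ (↭-swap _ _ ↭-refl)) id

  exchangeʳ : S ∣∼ Γ⁺ ▷ φ ∷ ψ ∷ Δ → S ∣∼ Γ⁺ ▷ ψ ∷ φ ∷ Δ
  exchangeʳ = thin id (⊆-reflexive-↭ (↭-swap _ _ ↭-refl))

  -- The context `Γ′` is what makes the induction work: the head waits there while the tail is
  -- folded into one conjunction. `▷⋁` does the same on the right.
  ⋀▷ : ∀ φ Γ Γ′ → S ∣∼ φ ∷ Γ ++ Γ′ ▷ Δ⁺ → S ∣∼ ⋀ (φ ∷ Γ) ∷ Γ′ ▷ Δ⁺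
  ⋀▷ φ []      Γ′ d = d
  ⋀▷ φ (ψ ∷ Γ) Γ′ d = ∧▷ (exchangeˡ (⋀▷ ψ Γ (φ ∷ Γ′)
    (thin (⊆-reflexive-↭ (↭-sym (shift φ (ψ ∷ Γ) Γ′))) id d)))

  ▷⋁ : ∀ φ Δ Δ′ → S ∣∼ Γ⁺ ▷ φ ∷ Δ ++ Δ′ → S ∣∼ Γ⁺ ▷ ⋁ (φ ∷ Δ) ∷ Δ′
  ▷⋁ φ []      Δ′ d = d
  ▷⋁ φ (ψ ∷ Δ) Δ′ d = ▷∨ (exchangeʳ (▷⋁ ψ Δ (φ ∷ Δ′)
    (thin id (⊆-reflexive-↭ (↭-sym (shift φ (ψ ∷ Δ) Δ′))) d)))

  ▷⋀ : ∀ Γ → All (λ γ → S ∣∼ Γ⁺ ▷ γ ∷ Δ) (toList Γ) → S ∣∼ Γ⁺ ▷ ⋀ Γ ∷ Δ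
  ▷⋀ (φ ∷ [])    (d ∷ [])  = d
  ▷⋀ (φ ∷ ψ ∷ Γ) (d ∷ ds) = ▷∧ d (▷⋀ (ψ ∷ Γ) ds)

  ⋁▷ : ∀ Δ → All (λ δ → S ∣∼ δ ∷ Γ ▷ Δ⁺) (toList Δ) → S ∣∼ ⋁ Δ ∷ Γ ▷ Δ⁺
  ⋁▷ (φ ∷ [])    (d ∷ [])  = d
  ⋁▷ (φ ∷ ψ ∷ Δ) (d ∷ ds) = ∨▷ d (⋁▷ (ψ ∷ Δ) ds)

  infix 4 _≤_
  _≤_ : Rel Formula p
  φ ≤ ψ = S ∣∼ [ φ ] ▷ [ ψ ]

  ⋀≤⋁ : ∀ Γ Δ → S ∣∼ Γ ▷ Δ → ⋀ Γ ≤ ⋁ Δ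
  ⋀≤⋁ (φ ∷ Γ) (ψ ∷ Δ) d = ⋀▷ φ Γ [] (▷⋁ ψ Δ [] (thin ∈-++⁺ˡ ∈-++⁺ˡ d))

  ⋀≤⋁⁻¹ : ∀ Γ Δ → ⋀ Γ ≤ ⋁ Δ → S ∣∼ Γ ▷ Δ
  ⋀≤⋁⁻¹ Γ Δ d =
    -- The outer cut leaves the antecedent `Γ ⁺++ []`, which has the same members as `Γ`.
    thin ([ id , (λ ()) ]′ ∘ ∈-++⁻ (toList Γ)) id (cut {Γ′ = []} Γ▷⋀Γ (cut {Γ′ = []} d ⋁Δ▷Δ))
    where
    Γ▷⋀Γ : S ∣∼ Γ ▷ [ ⋀ Γ ]
    Γ▷⋀Γ = ▷⋀ Γ (All.tabulate λ γ∈Γ → ax-∈ γ∈Γ (here ≡.refl))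
    ⋁Δ▷Δ : S ∣∼ [ ⋁ Δ ] ▷ Δ
    ⋁Δ▷Δ = ⋁▷ Δ (All.tabulate λ δ∈Δ → ax-∈ (here ≡.refl) δ∈Δ)

  ax₂ˡ : S ∣∼ φ ∷ ψ ∷ Γ ▷ ψ ∷ Δ
  ax₂ˡ = ax-∈ (there (here ≡.refl)) (here ≡.refl)

  ax₂ʳ : S ∣∼ ψ ∷ Γ ▷ φ ∷ ψ ∷ Δ
  ax₂ʳ = ax-∈ (here ≡.refl) (there (here ≡.refl))

  -- Formulas are lifted so that the carrier can sit at any prescribed level `c`; the order already
  -- lives at the level of `S`.
  lindenbaumLattice : ∀ c → DistributiveLattice c p p
  lindenbaumLattice c = record
    { Carrier = Lift c Formula
    ; _≈_ = SymInterior (_≤_ on lower)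
    ; _≤_ = _≤_ on lower
    ; _∨_ = λ φ ψ → lift (lower φ ∨ lower ψ)
    ; _∧_ = λ φ ψ → lift (lower φ ∧ lower ψ)
    ; isDistributiveLattice = record
      { isLattice = record
        { isPartialOrder = Interior.isPartialOrder ax cut
        ; supremum = λ _ _ → ▷∨ ax , ▷∨ ax₂ʳ , λ _ → ∨▷
        ; infimum = λ _ _ → ∧▷ ax , ∧▷ ax₂ˡ , λ _ → ▷∧
        }
      ; ∧-distribˡ-∨ = λ _ _ _ →
          -- Distributivity comes from side formulas: the first conjunct stays in the antecedent
          -- while the disjunction is split.
          ∧▷ (exchangeˡ (∨▷ (▷∨ (▷∧ ax₂ˡ ax)) (▷∨ (exchangeʳ (▷∧ ax₂ˡ ax))))) ,
          ∨▷ (∧▷ (▷∧ ax (▷∨ ax₂ˡ))) (∧▷ (▷∧ ax (▷∨ (exchangeʳ ax₂ˡ))))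
      }
    }

-- The canonical model

module CanonicalModel (S : Pred Sequent p) (c : Level) where
  open Derivability S
  private
    L = lindenbaumLattice c
    module L where
      open DistributiveLattice L public
      open JoinProperties joinSemilattice public using (∨-cong)
      open MeetProperties meetSemilattice public using (∧-cong)
    variable
      φ ψ : Formula
  open ProductBilattice L public

  infix 4 _⊣⊢_
  _⊣⊢_ : Rel Formula p
  φ ⊣⊢ ψ = lift φ L.≈ lift ψ

  -- These equivalences match the coordinate operations of `L ⊙ L` with the connectives: `⊗` and `⊕`
  -- in the first coordinate, negated formulas in the second.
  ∧⊣⊢⊗ : φ ∧ ψ ⊣⊢ φ ⊗ ψ
  ∧⊣⊢⊗ = ∧▷ (▷⊗ ax ax₂ˡ) , ⊗▷ (▷∧ ax ax₂ˡ)

  ∨⊣⊢⊕ : φ ∨ ψ ⊣⊢ φ ⊕ ψ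
  ∨⊣⊢⊕ = ▷⊕ (∨▷ ax ax₂ʳ) , ▷∨ (⊕▷ ax ax₂ʳ)

  ∨⊣⊢¬∧ : ¬ φ ∨ ¬ ψ ⊣⊢ ¬ (φ ∧ ψ)
  ∨⊣⊢¬∧ = ▷¬∧ (∨▷ ax ax₂ʳ) , ▷∨ (¬∧▷ ax ax₂ʳ)

  ∧⊣⊢¬∨ : ¬ φ ∧ ¬ ψ ⊣⊢ ¬ (φ ∨ ψ)
  ∧⊣⊢¬∨ = ∧▷ (▷¬∨ ax ax₂ˡ) , ¬∨▷ (▷∧ ax ax₂ˡ)

  ∧⊣⊢¬⊗ : ¬ φ ∧ ¬ ψ ⊣⊢ ¬ (φ ⊗ ψ)
  ∧⊣⊢¬⊗ = ∧▷ (▷¬⊗ ax ax₂ˡ) , ¬⊗▷ (▷∧ ax ax₂ˡ)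

  ∨⊣⊢¬⊕ : ¬ φ ∨ ¬ ψ ⊣⊢ ¬ (φ ⊕ ψ)
  ∨⊣⊢¬⊕ = ▷¬⊕ (∨▷ ax ax₂ʳ) , ▷∨ (¬⊕▷ ax ax₂ʳ)

  φ⊣⊢¬¬φ : φ ⊣⊢ ¬ ¬ φ
  φ⊣⊢¬¬φ = ▷¬¬ ax , ¬¬▷ ax

  h : ℕ → Algebra.Carrier algebra
  h x = lift (var x) , lift (¬ var x)

  -- The two inductions are simultaneous because negation swaps the coordinates; returning from the
  -- second to the first costs a double negation.
  value₁ : ∀ φ → proj₁ (⟦ algebra ⟧ φ h) L.≈ lift φ
  value₂ : ∀ φ → proj₂ (⟦ algebra ⟧ φ h) L.≈ lift (¬ φ)

  value₁ (var x) = L.Eq.refl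
  value₁ (φ ∧ ψ) = L.∧-cong (value₁ φ) (value₁ ψ)
  value₁ (φ ∨ ψ) = L.∨-cong (value₁ φ) (value₁ ψ)
  value₁ (φ ⊗ ψ) = L.Eq.trans (L.∧-cong (value₁ φ) (value₁ ψ)) ∧⊣⊢⊗
  value₁ (φ ⊕ ψ) = L.Eq.trans (L.∨-cong (value₁ φ) (value₁ ψ)) ∨⊣⊢⊕
  value₁ (¬ φ)   = value₂ φ

  value₂ (var x) = L.Eq.refl
  value₂ (φ ∧ ψ) = L.Eq.trans (L.∨-cong (value₂ φ) (value₂ ψ)) ∨⊣⊢¬∧
  value₂ (φ ∨ ψ) = L.Eq.trans (L.∧-cong (value₂ φ) (value₂ ψ)) ∧⊣⊢¬∨
  value₂ (φ ⊗ ψ) = L.Eq.trans (L.∧-cong (value₂ φ) (value₂ ψ)) ∧⊣⊢¬⊗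
  value₂ (φ ⊕ ψ) = L.Eq.trans (L.∨-cong (value₂ φ) (value₂ ψ)) ∨⊣⊢¬⊕
  value₂ (¬ φ)   = L.Eq.trans (value₁ φ) φ⊣⊢¬¬φ

  derivable⇒satisfies : ∀ s → S ∣∼ s → ∀ {e} → e ∈ members (τ s) → Satisfies algebra h e
  derivable⇒satisfies (Γ ▷ Δ) d (here ≡.refl) = ≤⇒x∧[x⊗y]≈x
    (L.trans (L.reflexive (value₁ (⋀ Γ)))
      (L.trans (⋀≤⋁ Γ Δ d) (L.reflexive (L.Eq.sym (value₁ (⋁ Δ))))))

  satisfies⇒derivable : ∀ s → (∀ {e} → e ∈ members (τ s) → Satisfies algebra h e) → S ∣∼ s
  satisfies⇒derivable (Γ ▷ Δ) sat = ⋀≤⋁⁻¹ Γ Δ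
    (L.trans (L.reflexive (L.Eq.sym (value₁ (⋀ Γ))))
      (L.trans (x∧[x⊗y]≈x⇒≤ (sat (here ≡.refl))) (L.reflexive (value₁ (⋁ Δ)))))

-- Algebraizability

theorem3p5p1 : ∀ {c ℓ} → Algebraizable (DBiLat {c} {ℓ}) τ ρ
theorem3p5p1 {c} {ℓ} = record { faithful = faithful ; inverse = inverse }
  where
  faithful : ∀ (S : Pred Sequent ℓ) s → (S ∣∼ s) ⇔ (⋃ S τ ⊨[ DBiLat {c} {ℓ} ] members (τ s))
  faithful S s = mk⇔ soundness completeness
    where
    soundness : S ∣∼ s → ⋃ S τ ⊨[ DBiLat {c} {ℓ} ] members (τ s)
    soundness d A isDBL h sat = ⊨⇒satisfies s
      (sound (λ {s′} s′∈S → satisfies⇒⊨ s′ (λ e∈ → sat (s′ , s′∈S , e∈))) d)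
      where open Soundness isDBL h

    completeness : ⋃ S τ ⊨[ DBiLat {c} {ℓ} ] members (τ s) → S ∣∼ s
    -- The canonical model of `S` satisfies the translations of all members of `S`, these being
    -- derivable by `hyp`; validity there gives the translation of `s`, hence a derivation.
    completeness valid = satisfies⇒derivable s
      (valid algebra isDistributiveBilattice h
        (λ { (s′ , s′∈S , e∈) → derivable⇒satisfies s′ (hyp s′∈S) e∈ }))
      where open CanonicalModel S c

  inverse : ∀ e → (｛ e ｝ ⊨[ DBiLat {c} {ℓ} ] ⋃ (members (ρ e)) τ) ×
                  (⋃ (members (ρ e)) τ ⊨[ DBiLat {c} {ℓ} ] ｛ e ｝)
  inverse (φ ≈ ψ) = forward , backward
    where
    forward : ｛ φ ≈ ψ ｝ ⊨[ DBiLat {c} {ℓ} ] ⋃ (members (ρ (φ ≈ ψ))) τ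
    forward A isDBL h sat (_ , s∈ , e∈) = go s∈ e∈
      where
      open Soundness isDBL h
      open Algebra A using (¬-cong)
      eq = sat ≡.refl
      below : ∀ φ ψ → Algebra._≈_ A (v φ) (v ψ) →
              ∀ {e} → e ∈ members (τ ([ φ ] ▷ [ ψ ])) → Satisfies A h e
      below φ ψ φ≈ψ (here ≡.refl) = T.Eq.sym (≈⇒⊑ φ≈ψ)
      go : ∀ {s e} → s ∈ members (ρ (φ ≈ ψ)) → e ∈ members (τ s) → Satisfies A h e
      go (here ≡.refl)                         = below φ ψ eq
      go (there (here ≡.refl))                 = below (¬ φ) (¬ ψ) (¬-cong eq)
      go (there (there (here ≡.refl)))         = below ψ φ (T.Eq.sym eq)
      go (there (there (there (here ≡.refl)))) = below (¬ ψ) (¬ φ) (¬-cong (T.Eq.sym eq))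

    backward : ⋃ (members (ρ (φ ≈ ψ))) τ ⊨[ DBiLat {c} {ℓ} ] ｛ φ ≈ ψ ｝
    backward A isDBL h sat ≡.refl = ⊑-antisym
      -- `ρ` lists `¬ φ ▷ ¬ ψ` before `ψ ▷ φ`, whereas `⊑-antisym` takes both unnegated inequalities
      -- first.
      (below (here ≡.refl))
      (below (there (there (here ≡.refl))))
      (below (there (here ≡.refl)))
      (below (there (there (there (here ≡.refl)))))
      where
      open Soundness isDBL h
      below : ∀ {φ′ ψ′} → ([ φ′ ] ▷ [ ψ′ ]) ∈ members (ρ (φ ≈ ψ)) → v φ′ ⊑ v ψ′
      below s∈ = T.Eq.sym (sat (_ , s∈ , here ≡.refl))
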